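{- Let $b\geq 2$, $e\geq 1$, $h\geq 1$, $u\geq 1$ be integers. Write the base $b$ expansion $\sigma_{h,e,b}(u)=\sum_{i=0}^{n-1}a_{i}b^i$. If $a_{0}=a_1=\dots=a_{e+p_{e,b}}=b-1$ (that is, the rightmost $e+p_{e,b}+1$ base $b$ digits of $\sigma_{h,e,b}(u)$ are all equal to $b-1$), then $$S_{e,b}(\sigma_{h+1,e,b}(u))=\sigma_{h,e,b}(u).$$
   Context: For integers $b\ge 2$ and $e\ge 1$, $S_{e,b}$ is the function on positive integers sending $x=\sum_{i=0}^{n-1}a_i b^i$ (with digits $0\le a_i\le b-1$) to $S_{e,b}(x)=\sum_{i=0}^{n-1}a_i^e$. $S_{e,b}^{h}$ denotes the $h$-fold iterate, with $S_{e,b}^0(x)=x$. For a positive integer $u$ (the attractor), a positive integer $x$ is a height $h$, $u$ attracted number if $h$ is the smallest nonnegative integer with $S_{e,b}^h(x)=u$. $\sigma_{h,e,b}(u)$ denotes the smallest height $h$, $u$ attracted number, i.e. the smallest positive integer $k$ with $S_{e,b}^h(k)=u$ and $S_{e,b}^m(k)\neq u$ for all $0\le m<h$. $g(e)$ denotes the smallest integer such that every nonnegative integer can be written as $x_1^e+x_2^e+\dots+x_{g(e)}^e$ with $x_1,\dots,x_{g(e)}$ nonnegative integers (Waring's problem). $p_{e,b}$ denotes the smallest integer such that $b^{p_{e,b}}>g(e)$. In the expansion, $n$ is the number of base $b$ digits and $0\le a_i\le b-1$. -}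

module Defs where

open import Data.Digit using (Expansion; fromDigits; toDigits)
open import Data.Fin using (toℕ; zero; suc)
open import Data.Fin.Properties using (toℕ<n)
open import Data.List using (List; []; _∷_; map)
open import Data.Nat
open import Data.Nat.DivMod using (_%_; [m+kn]%n≡m%n; m<n⇒m%n≡m)
open import Data.Nat.GeneralisedArithmetic using (iterate)
open import Data.Nat.ListAction using (sum)
open import Data.Nat.Properties
open import Data.Product using (∃; _×_; _,_; proj₁; proj₂)
open import Data.Vec as Vec using (Vec)
open import Level using (0ℓ)
open import Relation.Binary.PropositionalEquality
open import Relation.Nullary using (yes; no)
open import Relation.Nullary.Decidable using (fromWitness; map′; ¬?; _×-dec_)
open import Relation.Unary using (Pred; Decidable)

IsLeast : Pred ℕ 0ℓ → Pred ℕ 0ℓ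
IsLeast P n = P n × (∀ m → P m → n ≤ m)

-- Least significant digit first; no leading zeros when x > 0.
digits : (b : ℕ) .{{_ : NonTrivial b}} → ℕ → List ℕ
digits b x = map toℕ (proj₁ (toDigits b {fromWitness (nonTrivial⇒n>1 b)} x))

S : (e b : ℕ) .{{_ : NonTrivial b}} → ℕ → ℕ
S e b x = sum (map (_^ e) (digits b x))

-- Minimality of h is expressed by u not being reached in fewer steps.
record Attracted (h e b : ℕ) .{{_ : NonTrivial b}} (u x : ℕ) : Set where
  constructor attracted
  field
    positive : 0 < x
    reaches  : iterate (S e b) x h ≡ u
    minimal  : ∀ m → m < h → iterate (S e b) x m ≢ u

-- σ is total: an x of height 1 + h is obtained from a y of height h as the
-- number with y ones in base b, followed by a zero if that number is u itself.

powerSum : ∀ {b} → ℕ → Expansion b → ℕ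
powerSum e ds = sum (map (_^ e) (map toℕ ds))

0^e≡0 : ∀ e .{{_ : NonZero e}} → 0 ^ e ≡ 0
0^e≡0 (suc _) = refl

module _ {b : ℕ} .{{_ : NonTrivial b}} (e : ℕ) .{{_ : NonZero e}} where

  private instance
    b≢0 : NonZero b
    b≢0 = nonTrivial⇒nonZero b

  powerSum-zero : (ds : Expansion b) → fromDigits ds ≡ 0 → powerSum e ds ≡ 0
  powerSum-zero []       _  = refl
  powerSum-zero (d ∷ ds) eq = cong₂ _+_
    (trans (cong (_^ e) (m+n≡0⇒m≡0 (toℕ d) eq)) (0^e≡0 e))
    (powerSum-zero ds (m*n≡0⇒m≡0 _ b (m+n≡0⇒n≡0 (toℕ d) eq)))

  powerSum-unique : (ds ds′ : Expansion b) → fromDigits ds ≡ fromDigits ds′ →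
                    powerSum e ds ≡ powerSum e ds′
  powerSum-unique []       ds′        eq = sym (powerSum-zero ds′ (sym eq))
  powerSum-unique (d ∷ ds) []         eq = powerSum-zero (d ∷ ds) eq
  powerSum-unique (d ∷ ds) (d′ ∷ ds′) eq =
    cong₂ _+_ (cong (_^ e) d≡d′) (powerSum-unique ds ds′ ds≡ds′)
    where
    last : ∀ d (v : ℕ) → (toℕ {b} d + v * b) % b ≡ toℕ d
    last d v = trans ([m+kn]%n≡m%n (toℕ d) v b) (m<n⇒m%n≡m (toℕ<n d))

    d≡d′ : toℕ d ≡ toℕ d′
    d≡d′ = trans (sym (last d (fromDigits ds)))
                 (trans (cong (_% b) eq) (last d′ (fromDigits ds′)))

    ds≡ds′ : fromDigits ds ≡ fromDigits ds′
    ds≡ds′ = *-cancelʳ-≡ _ _ b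
      (+-cancelˡ-≡ (toℕ d) _ _
        (trans eq (cong (_+ fromDigits ds′ * b) (sym d≡d′))))

  S-fromDigits : (ds : Expansion b) → S e b (fromDigits ds) ≡ powerSum e ds
  S-fromDigits ds = powerSum-unique (proj₁ xs) ds (proj₂ xs)
    where xs = toDigits b {fromWitness (nonTrivial⇒n>1 b)} (fromDigits ds)

ones : ∀ k → ℕ → Expansion (2+ k)
ones k zero    = []
ones k (suc n) = suc zero ∷ ones k n

powerSum-ones : ∀ e k n → powerSum e (ones k n) ≡ n
powerSum-ones e k zero    = refl
powerSum-ones e k (suc n) = cong₂ _+_ (^-zeroˡ e) (powerSum-ones e k n)

preimage : ∀ e b .{{_ : NonTrivial b}} .{{_ : NonZero e}} u y → 0 < y →
           ∃ λ x → 0 < x × S e b x ≡ y × x ≢ u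
preimage e b@(2+ k) u (suc n) _ with fromDigits (ones k (suc n)) ≟ u
... | no x≢u = _ , s≤s z≤n ,
  trans (S-fromDigits e (ones k (suc n))) (powerSum-ones e k (suc n)) , x≢u
... | yes refl = fromDigits (zero ∷ ones k (suc n)) , s≤s z≤n ,
  trans (S-fromDigits e (zero ∷ ones k (suc n)))
        (cong₂ _+_ (0^e≡0 e) (powerSum-ones e k (suc n))) ,
  λ eq → <⇒≢ (m<m*n _ b (s≤s (s≤s z≤n))) (sym eq)

attracted-exists : ∀ h e b u .{{_ : NonTrivial b}} .{{_ : NonZero e}}
                   .{{_ : NonZero u}} → ∃ (Attracted h e b u)
attracted-exists zero e b u = u , attracted (>-nonZero⁻¹ u) refl λ _ ()
attracted-exists (suc h) e b u
  with y , attracted y>0 reaches minimal ← attracted-exists h e b u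
  with x , x>0 , refl , x≢u ← preimage e b u y y>0
  = x , attracted x>0 reaches λ where
      zero    _         → x≢u
      (suc m) (s≤s m<h) → minimal m m<h

attracted? : ∀ h e b u .{{_ : NonTrivial b}} → Decidable (Attracted h e b u)
attracted? h e b u x = map′
  (λ (p , r , m) → attracted p r λ _ → m)
  (λ (attracted p r m) → p , r , λ {n} → m n)
  (0 <? x ×-dec iterate (S e b) x h ≟ u ×-dec
    allUpTo? (λ m → ¬? (iterate (S e b) x m ≟ u)) h)

least : ∀ {P : Pred ℕ 0ℓ} → Decidable P → ∃ P → ∃ (IsLeast P)
least {P} P? (n , Pn) = search n 0 (subst P (sym (+-identityʳ n)) Pn) λ _ _ → z≤n
  where
  search : ∀ n k → P (n + k) → (∀ m → P m → k ≤ m) → ∃ (IsLeast P)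
  search zero    k Pk below = k , Pk , below
  search (suc n) k Pn below with P? k
  ... | yes Pk = k , Pk , below
  ... | no ¬Pk = search n (suc k) (subst P (sym (+-suc n k)) Pn) λ m Pm →
    ≤∧≢⇒< (below m Pm) λ { refl → ¬Pk Pm }

least-attracted : ∀ h e b u .{{_ : NonTrivial b}} .{{_ : NonZero e}}
                  .{{_ : NonZero u}} → ∃ (IsLeast (Attracted h e b u))
least-attracted h e b u =
  least (attracted? h e b u) (attracted-exists h e b u)

σ : ∀ h e b u .{{_ : NonTrivial b}} .{{_ : NonZero e}} .{{_ : NonZero u}} → ℕ
σ h e b u = proj₁ (least-attracted h e b u)

SumsOfPowers : (e k : ℕ) → Set
SumsOfPowers e k = ∀ n → ∃ λ (xs : Vec ℕ k) → Vec.sum (Vec.map (_^ e) xs) ≡ n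

-- The existence of g(e) is the Hilbert–Waring theorem, so g is characterised
-- by a predicate instead of being defined as a function.
IsWaring : (e g : ℕ) → Set
IsWaring e = IsLeast (SumsOfPowers e)

-- p is p_{e,b} when g is g(e).
IsDigitBound : (b g p : ℕ) → Set
IsDigitBound b g = IsLeast (λ k → b ^ k > g)

{-# OPTIONS --safe #-}

-- Write s = σ_h, D = (b ∸ 1)^e, m = e + p and y = S(σ_{h+1}); then y ≥ s.
-- Division of s by D and Waring's theorem for the remainder give a preimage of
-- s with at most s / D + g digits, and minimality of σ_{h+1} turns this into
-- y ≤ s + g D < s + b^m. If y > s, the trailing digits b ∸ 1 of s force
-- y = C b^(1+m) + r with r < b^m, so the digit of y at position m is zero.
-- Deleting it gives a number y′ < s with S(y′) = S(y), which contradicts the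
-- minimality of s. Both modified numbers could only fail to have the right
-- height by being u itself, and then S would have a periodic point ≥ b^m; but
-- S(x) < u whenever x ≤ u and b^m ≤ u.

module Submission where

open import Defs
open import Data.Digit using (Expansion; fromDigits; toDigits)
open import Data.Fin using (Fin; toℕ; fromℕ<)
open import Data.Fin.Properties using (toℕ<n; toℕ-fromℕ<)
open import Data.List using ([]; _∷_; map; take; replicate; length)
open import Data.List.Properties using (∷-injective)
open import Data.Nat
open import Data.Nat.DivMod
open import Data.Nat.GeneralisedArithmetic using (iterate)
open import Data.Nat.Properties
open import Data.Nat.Tactic.RingSolver using (solve-∀)
open import Data.Product using (∃; _×_; _,_; proj₁; proj₂)
open import Data.Sum using (inj₁; inj₂)
open import Data.Vec as Vec using (Vec; []; _∷_)
open import Relation.Binary.PropositionalEquality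
open import Relation.Nullary using (contradiction; yes; no)
open import Relation.Nullary.Decidable using (fromWitness)

-- Linear against exponential growth

bernoulli : ∀ x n → 1 + n * x ≤ suc x ^ n
bernoulli x zero    = ≤-refl
bernoulli x (suc n) = begin
  1 + (x + n * x)               ≤⟨ m≤m+n _ (x * (n * x)) ⟩
  1 + (x + n * x) + x * (n * x) ≡⟨ expand x n ⟩
  suc x * (1 + n * x)           ≤⟨ *-monoʳ-≤ (suc x) (bernoulli x n) ⟩
  suc x * suc x ^ n             ∎
  where
  open ≤-Reasoning
  expand : ∀ x n → 1 + (x + n * x) + x * (n * x) ≡ suc x * (1 + n * x)
  expand = solve-∀

n<2^n : ∀ n → n < 2 ^ n
n<2^n n = subst (λ k → suc k ≤ 2 ^ n) (*-identityʳ n) (bernoulli 1 n)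

2*n≤2^n : ∀ n .{{_ : NonZero n}} → 2 * n ≤ 2 ^ n
2*n≤2^n (suc n) = *-monoʳ-≤ 2 (n<2^n n)

^-cancelˡ-< : ∀ e {x y} → x ^ e < y ^ e → x < y
^-cancelˡ-< e x^e<y^e = ≰⇒> λ y≤x → <⇒≱ x^e<y^e (^-monoˡ-≤ e y≤x)

^-cancelʳ-≤ : ∀ b .{{_ : NonTrivial b}} {m n} → b ^ m ≤ b ^ n → m ≤ n
^-cancelʳ-≤ b b^m≤b^n =
  ≮⇒≥ λ n<m → <⇒≱ (^-monoʳ-< b (nonTrivial⇒n>1 b) n<m) b^m≤b^n

-- Starting point for bounding `S` on numbers of `suc (e + p)` or more digits. Base 2 is treated
-- apart because `suc (e + p) ≤ b ^ p` can fail there, for instance at e = p = 1.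
linear<exponential : ∀ b e p .{{_ : NonTrivial b}} .{{_ : NonZero e}} →
                     2 ^ e ≤ b ^ p →
                     suc (e + p) * (b ∸ 1) ^ e < b ^ (e + p)
-- Here 1 ≤ e ≤ p, so `e * p` is positive, and this makes the bound strict.
linear<exponential 2 e@(suc e′) p 2^e≤2^p with p | ^-cancelʳ-≤ 2 {e} {p} 2^e≤2^p
... | p@(suc p′) | _ = begin-strict
  suc (e + p) * 1 ^ e       ≡⟨ cong (suc (e + p) *_) (^-zeroˡ e) ⟩
  suc (e + p) * 1           ≡⟨ *-identityʳ _ ⟩
  suc (e + p)               <⟨ m<m+n (suc (e + p)) z<s ⟩
  suc (e + p) + e * p       ≡⟨ expand e p ⟩
  suc e * suc p             ≤⟨ *-mono-≤ (n<2^n e) (n<2^n p) ⟩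
  2 ^ e * 2 ^ p             ≡⟨ ^-distribˡ-+-* 2 e p ⟨
  2 ^ (e + p)               ∎
  where
  open ≤-Reasoning
  expand : ∀ x y → suc (x + y) + x * y ≡ suc x * suc y
  expand = solve-∀
linear<exponential b@(2+ b′@(suc k)) e p 2^e≤b^p = begin-strict
  suc (e + p) * suc b′ ^ e   <⟨ *-monoʳ-< (suc (e + p)) (^-monoˡ-< e ≤-refl) ⟩
  suc (e + p) * b ^ e        ≤⟨ *-monoˡ-≤ (b ^ e) 1+e+p≤b^p ⟩
  b ^ p * b ^ e              ≡⟨ *-comm (b ^ p) (b ^ e) ⟩
  b ^ e * b ^ p              ≡⟨ ^-distribˡ-+-* b e p ⟨
  b ^ (e + p)                ∎
  where
  open ≤-Reasoning
  1+e+p≤b^p : suc (e + p) ≤ b ^ p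
  1+e+p≤b^p with e ≤? p
  ... | yes e≤p = begin
    suc (e + p)    ≤⟨ s≤s (+-monoˡ-≤ p e≤p) ⟩
    suc (p + p)    ≡⟨ cong suc (trans (cong (p +_) (sym (+-identityʳ p)))
                                      (*-comm 2 p)) ⟩
    1 + p * 2      ≤⟨ bernoulli 2 p ⟩
    3 ^ p          ≤⟨ ^-monoˡ-≤ p (s≤s (s≤s (s≤s z≤n))) ⟩
    b ^ p          ∎
  ... | no e≰p = begin
    suc (e + p)    ≡⟨ +-suc e p ⟨
    e + suc p      ≤⟨ +-monoʳ-≤ e (≰⇒> e≰p) ⟩
    e + e          ≡⟨ cong (e +_) (+-identityʳ e) ⟨
    2 * e          ≤⟨ 2*n≤2^n e ⟩
    2 ^ e          ≤⟨ 2^e≤b^p ⟩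
    b ^ p          ∎

-- Each step at most doubles the left side and multiplies the right side by b ≥ 2.
linear<exponential-mono : ∀ b .{{_ : NonTrivial b}} D {m n} → m ≤ n →
                          suc m * D < b ^ m → suc n * D < b ^ n
linear<exponential-mono b D {m} {n} m≤n base with m≤n⇒m<n∨m≡n m≤n
... | inj₂ refl = base
linear<exponential-mono b D {m} {suc n} _ base | inj₁ (s≤s m≤n) = begin-strict
  D + suc n * D        ≤⟨ +-monoˡ-≤ (suc n * D) (m≤m+n D (n * D)) ⟩
  suc n * D + suc n * D ≡⟨ cong (suc n * D +_) (+-identityʳ (suc n * D)) ⟨
  2 * (suc n * D)      ≤⟨ *-monoˡ-≤ (suc n * D) (nonTrivial⇒n>1 b) ⟩
  b * (suc n * D)      <⟨ *-monoʳ-< b {{nonTrivial⇒nonZero b}} (linear<exponential-mono b D m≤n base) ⟩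
  b * b ^ n            ∎
  where open ≤-Reasoning

-- A lower bound for Waring's constant

sumOfPowers≤length : ∀ e {k} (xs : Vec ℕ k) → Vec.sum (Vec.map (_^ e) xs) < 2 ^ e →
                     Vec.sum (Vec.map (_^ e) xs) ≤ k
sumOfPowers≤length e []       _     = z≤n
sumOfPowers≤length e (x ∷ xs) small = +-mono-≤
  (≤-trans (^-monoˡ-≤ e (s≤s⁻¹ (^-cancelˡ-< e {y = 2} (≤-<-trans (m≤m+n _ _) small))))
           (≤-reflexive (^-zeroˡ e)))
  (sumOfPowers≤length e xs (≤-<-trans (m≤n+m _ (x ^ e)) small))

-- A sum equal to 2^e - 1 has no base above 1, so each of its g terms contributes at most 1.
waring-lower-bound : ∀ {e g} → SumsOfPowers e g → 2 ^ e ≤ suc g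
waring-lower-bound {e} {g} waring
  with xs , eq ← waring (pred (2 ^ e)) = begin
  2 ^ e              ≡⟨ suc-pred (2 ^ e) {{m^n≢0 2 e}} ⟨
  suc (pred (2 ^ e)) ≡⟨ cong suc eq ⟨
  suc _              ≤⟨ s≤s (sumOfPowers≤length e xs small) ⟩
  suc g              ∎
  where
  open ≤-Reasoning
  small : Vec.sum (Vec.map (_^ e) xs) < 2 ^ e
  small = ≤-reflexive (trans (cong suc eq) (suc-pred (2 ^ e) {{m^n≢0 2 e}}))

-- Digit expansions: trailing digits and short preimages

module _ {b : ℕ} .{{_ : NonTrivial b}} where

  private instance
    b≢0 : NonZero b
    b≢0 = nonTrivial⇒nonZero b

    b∸1≢0 : NonZero (b ∸ 1)
    b∸1≢0 = >-nonZero (m<n⇒0<n∸m (nonTrivial⇒n>1 b))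

  private
    b∸1<b : b ∸ 1 < b
    b∸1<b = ≤-reflexive (suc-pred b)

  fromDigits-< : (ds : Expansion b) → fromDigits ds < b ^ length ds
  fromDigits-< []       = s≤s z≤n
  fromDigits-< (d ∷ ds) = begin-strict
    toℕ d + fromDigits ds * b   <⟨ +-monoˡ-< (fromDigits ds * b) (toℕ<n d) ⟩
    suc (fromDigits ds) * b     ≤⟨ *-monoˡ-≤ b (fromDigits-< ds) ⟩
    b ^ length ds * b           ≡⟨ *-comm (b ^ length ds) b ⟩
    b ^ suc (length ds)         ∎
    where open ≤-Reasoning

  -- Adding one carries through all k trailing digits; c is the value of the digits above them.
  fromDigits-trailing : ∀ k (ds : Expansion b) →
                        take k (map toℕ ds) ≡ replicate k (b ∸ 1) →
                        ∃ λ c → suc (fromDigits ds) ≡ suc c * b ^ k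
  fromDigits-trailing zero    ds       _  = fromDigits ds , sym (*-identityʳ _)
  fromDigits-trailing (suc k) (d ∷ ds) eq
    with d≡b∸1 , eq′ ← ∷-injective eq
    with c , trailing ← fromDigits-trailing k ds eq′ = c , (begin
      suc (toℕ d) + fromDigits ds * b  ≡⟨ cong (λ x → suc x + fromDigits ds * b) d≡b∸1 ⟩
      suc (b ∸ 1) + fromDigits ds * b  ≡⟨ cong (_+ fromDigits ds * b) (suc-pred b) ⟩
      suc (fromDigits ds) * b          ≡⟨ cong (_* b) trailing ⟩
      suc c * b ^ k * b                ≡⟨ *-assoc (suc c) (b ^ k) b ⟩
      suc c * (b ^ k * b)              ≡⟨ cong (suc c *_) (*-comm (b ^ k) b) ⟩
      suc c * b ^ suc k                ∎)
    where open ≡-Reasoning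

  digits-trailing : ∀ k x → take k (digits b x) ≡ replicate k (b ∸ 1) →
                    ∃ λ c → suc x ≡ suc c * b ^ k
  digits-trailing k x eq =
    subst (λ z → ∃ λ c → suc z ≡ suc c * b ^ k) (proj₂ xs)
      (fromDigits-trailing k (proj₁ xs) eq)
    where xs = toDigits b {fromWitness (nonTrivial⇒n>1 b)} x

  -- With a sum this small every base is below b, so the bases themselves serve as digits.
  vecToExpansion : ∀ e {k} (xs : Vec ℕ k) → Vec.sum (Vec.map (_^ e) xs) < b ^ e →
                   ∃ λ (ds : Expansion b) → length ds ≡ k ×
                     powerSum e ds ≡ Vec.sum (Vec.map (_^ e) xs)
  vecToExpansion e []       _     = [] , refl , refl
  vecToExpansion e (x ∷ xs) small
    with ds , len , eq ← vecToExpansion e xs (≤-<-trans (m≤n+m _ (x ^ e)) small)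
    = fromℕ< x<b ∷ ds , cong suc len ,
      cong₂ _+_ (cong (_^ e) (toℕ-fromℕ< x<b)) eq
    where
    x<b : x < b
    x<b = ^-cancelˡ-< e (≤-<-trans (m≤m+n _ _) small)

  prependMaxDigits : ∀ e q (ds : Expansion b) → ∃ λ (ds′ : Expansion b) →
                     length ds′ ≡ q + length ds ×
                     powerSum e ds′ ≡ q * (b ∸ 1) ^ e + powerSum e ds
  prependMaxDigits e zero    ds = ds , refl , refl
  prependMaxDigits e (suc q) ds
    with ds′ , len , eq ← prependMaxDigits e q ds
    = fromℕ< b∸1<b ∷ ds′ , cong suc len ,
      trans (cong₂ _+_ (cong (_^ e) (toℕ-fromℕ< b∸1<b)) eq)
            (sym (+-assoc ((b ∸ 1) ^ e) _ _))

  -- The digits are s / D copies of b - 1, where D = (b - 1)^e, and g Waring bases for s % D, which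
  -- is below b^e. The length is multiplied by D to match the bound `S-≤`.
  shortExpansion : ∀ {e g} .{{_ : NonZero e}} → SumsOfPowers e g → ∀ s →
                   ∃ λ (ds : Expansion b) → powerSum e ds ≡ s ×
                     length ds * (b ∸ 1) ^ e ≤ s + g * (b ∸ 1) ^ e
  shortExpansion {e} {g} waring s
    with xs , sum-xs ← waring (_%_ s ((b ∸ 1) ^ e) {{m^n≢0 (b ∸ 1) e}})
    with ds , len , eq ← vecToExpansion e xs
           (subst (_< b ^ e) (sym sum-xs)
             (<-trans (m%n<n s ((b ∸ 1) ^ e) {{m^n≢0 (b ∸ 1) e}}) (^-monoˡ-< e b∸1<b)))
    with ds′ , len′ , eq′ ←
           prependMaxDigits e (_/_ s ((b ∸ 1) ^ e) {{m^n≢0 (b ∸ 1) e}}) ds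
    = ds′ , powerSum≡s , (begin
      length ds′ * D      ≡⟨ cong (_* D) (trans len′ (cong (q +_) len)) ⟩
      (q + g) * D         ≡⟨ *-distribʳ-+ D q g ⟩
      q * D + g * D       ≤⟨ +-monoˡ-≤ (g * D) (m/n*n≤m s D) ⟩
      s + g * D           ∎)
    where
    open ≤-Reasoning
    D = (b ∸ 1) ^ e
    instance
      D≢0 : NonZero D
      D≢0 = m^n≢0 (b ∸ 1) e
    q = s / D
    powerSum≡s : powerSum e ds′ ≡ s
    powerSum≡s = trans eq′ (trans (cong (q * D +_) (trans eq sum-xs))
      (trans (+-comm (q * D) (s % D)) (sym (m≡m%n+[m/n]*n s D))))

-- Digit splitting, size bounds and iteration of `S`

module _ {b : ℕ} .{{_ : NonTrivial b}} (e : ℕ) .{{_ : NonZero e}} where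

  private instance
    b≢0 : NonZero b
    b≢0 = nonTrivial⇒nonZero b

  S-zero : S e b 0 ≡ 0
  S-zero = S-fromDigits {b} e []

  S-∷ : ∀ (d : Fin b) x → S e b (toℕ d + x * b) ≡ toℕ d ^ e + S e b x
  S-∷ d x = trans (cong (λ z → S e b (toℕ d + z * b)) (sym (proj₂ xs)))
                  (S-fromDigits e (d ∷ proj₁ xs))
    where xs = toDigits b {fromWitness (nonTrivial⇒n>1 b)} x

  private
    quotient< : ∀ m r q → r + q * b < b ^ suc m → q < b ^ m
    quotient< m r q x<b^1+m = *-cancelˡ-< b q (b ^ m)
      (≤-<-trans (≤-trans (≤-reflexive (*-comm b q)) (m≤n+m (q * b) r)) x<b^1+m)

  -- The right side does not mention m, so zero digits between r and c can be inserted or deleted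
  -- freely.
  S-concat : ∀ m c {r} → r < b ^ m → S e b (r + c * b ^ m) ≡ S e b r + S e b c
  S-concat zero c {zero} _ =
    trans (cong (S e b) (*-identityʳ c)) (cong (_+ S e b c) (sym S-zero))
  S-concat zero c {suc _} (s≤s ())
  S-concat (suc m) c {r} r<b^1+m with r divMod b
  ... | result q d refl = begin
    S e b (toℕ d + q * b + c * (b * b ^ m))   ≡⟨ cong (S e b) (regroup (toℕ d) q c b (b ^ m)) ⟩
    S e b (toℕ d + (q + c * b ^ m) * b)       ≡⟨ S-∷ d (q + c * b ^ m) ⟩
    toℕ d ^ e + S e b (q + c * b ^ m)         ≡⟨ cong (toℕ d ^ e +_) (S-concat m c (quotient< m (toℕ d) q r<b^1+m)) ⟩
    toℕ d ^ e + (S e b q + S e b c)           ≡⟨ +-assoc (toℕ d ^ e) _ _ ⟨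
    toℕ d ^ e + S e b q + S e b c             ≡⟨ cong (_+ S e b c) (S-∷ d q) ⟨
    S e b (toℕ d + q * b) + S e b c           ∎
    where
    open ≡-Reasoning
    regroup : ∀ d q c b B → d + q * b + c * (b * B) ≡ d + (q + c * B) * b
    regroup = solve-∀

  S-≤ : ∀ n {x} → x < b ^ n → S e b x ≤ n * (b ∸ 1) ^ e
  S-≤ zero    {zero}  _ = ≤-reflexive S-zero
  S-≤ zero    {suc _} (s≤s ())
  S-≤ (suc n) {x} x<b^1+n with x divMod b
  ... | result q d refl = begin
    S e b (toℕ d + q * b)              ≡⟨ S-∷ d q ⟩
    toℕ d ^ e + S e b q                ≤⟨ +-mono-≤ (^-monoˡ-≤ e (<⇒≤pred (toℕ<n d)))
                                                   (S-≤ n (quotient< n (toℕ d) q x<b^1+n)) ⟩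
    (b ∸ 1) ^ e + n * (b ∸ 1) ^ e      ∎
    where open ≤-Reasoning

  module _ {m : ℕ} (D[1+m]<b^m : suc m * (b ∸ 1) ^ e < b ^ m) where

    -- If b^n ≤ u < b^(1+n), then x has at most 1 + n digits and n ≥ m, so `S` of x is below b^n.
    S-< : ∀ {u x} → b ^ m ≤ u → x ≤ u → S e b x < u
    S-< {u} b^m≤u x≤u with least (λ n → u <? b ^ n)
      (u , <-≤-trans (n<2^n u) (^-monoˡ-≤ u (nonTrivial⇒n>1 b)))
    ... | zero , u<b^n , _ =
      contradiction (≤-trans u<b^n (≤-trans (m^n>0 b m) b^m≤u)) (<-irrefl refl)
    ... | suc n , u<b^1+n , minimal = begin-strict
      S e b _                 ≤⟨ S-≤ (suc n) (≤-<-trans x≤u u<b^1+n) ⟩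
      suc n * (b ∸ 1) ^ e     <⟨ linear<exponential-mono b _ m≤n D[1+m]<b^m ⟩
      b ^ n                   ≤⟨ ≮⇒≥ (λ u<b^n → 1+n≰n (minimal n u<b^n)) ⟩
      u                       ∎
      where
      open ≤-Reasoning
      m≤n : m ≤ n
      m≤n = ≮⇒≥ λ n<m →
        <⇒≱ u<b^1+n (≤-trans (^-monoʳ-≤ b n<m) b^m≤u)

    iterate-S-< : ∀ {u x} h → b ^ m ≤ u → x < u → iterate (S e b) x h < u
    iterate-S-< zero    _     x<u = x<u
    iterate-S-< (suc h) b^m≤u x<u = iterate-S-< h b^m≤u (S-< b^m≤u (<⇒≤ x<u))

    -- The first step drops below u, and no later step climbs back.
    no-large-periodic : ∀ {u} h → b ^ m ≤ u → iterate (S e b) u (suc h) ≢ u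
    no-large-periodic h b^m≤u periodic =
      <-irrefl periodic (iterate-S-< h b^m≤u (S-< b^m≤u ≤-refl))

  iterate-S-zero : ∀ h → iterate (S e b) 0 h ≡ 0
  iterate-S-zero zero    = refl
  iterate-S-zero (suc h) = trans (cong (λ x → iterate (S e b) x h) S-zero) (iterate-S-zero h)

  iterate-suc : ∀ x h → iterate (S e b) x (suc h) ≡ S e b (iterate (S e b) x h)
  iterate-suc x zero    = refl
  iterate-suc x (suc h) = iterate-suc (S e b x) h

  attracted-S : ∀ {h u x} .{{_ : NonZero u}} →
                Attracted (suc h) e b u x → Attracted h e b u (S e b x)
  attracted-S {h} {u} {x} (attracted _ reaches minimal) = attracted
    -- Zero is a fixed point of `S`, so reaching it would force u to be 0.
    (n≢0⇒n>0 λ Sx≡0 → ≢-nonZero⁻¹ u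
      (trans (sym reaches)
        (trans (cong (λ y → iterate (S e b) y h) Sx≡0) (iterate-S-zero h))))
    reaches
    λ m m<h → minimal (suc m) (s≤s m<h)

  attracted-preimage : ∀ {h u x} → x ≢ u →
                       Attracted h e b u (S e b x) → Attracted (suc h) e b u x
  attracted-preimage x≢u (attracted Sx>0 reaches minimal) = attracted
    (n≢0⇒n>0 λ { refl → <-irrefl (sym S-zero) Sx>0 })
    reaches
    λ where
      zero    _         → x≢u
      (suc m) (s≤s m<h) → minimal m m<h

-- Comparing the two least attracted numbers

S-least-attracted : ∀ b e h u .{{_ : NonTrivial b}} .{{_ : NonZero e}} .{{_ : NonZero h}} .{{_ : NonZero u}} →
    ∀ g p → SumsOfPowers e g → b ^ p > g →
    ∀ {s t} → IsLeast (Attracted h e b u) s → IsLeast (Attracted (suc h) e b u) t →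
    ∀ c → suc s ≡ suc c * b ^ suc (e + p) →
    S e b t ≡ s
S-least-attracted b@(2+ _) e h@(suc h′) u g p waring g<b^p {s} {t} s-least t-least c suc-s
  = sym (≤∧≮⇒≡ (proj₂ s-least y (attracted-S e (proj₁ t-least))) s≮y)
  where
  open ≤-Reasoning
  m D y C : ℕ
  m = e + p
  D = (b ∸ 1) ^ e
  y = S e b t
  C = suc c

  no-periodic : ∀ {x} j → b ^ m ≤ x → iterate (S e b) x (suc j) ≢ x
  no-periodic = no-large-periodic e {m}
    -- The chain is 2^e ≤ 1 + g ≤ b^p.
    (linear<exponential b e p (≤-trans (waring-lower-bound {e} waring) g<b^p))

  gD<b^m : g * D < b ^ m
  gD<b^m = begin-strict
    g * D          ≤⟨ *-monoʳ-≤ g (^-monoˡ-≤ e (n≤1+n _)) ⟩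
    g * b ^ e      <⟨ *-monoˡ-< (b ^ e) {{m^n≢0 b e}} g<b^p ⟩
    b ^ p * b ^ e  ≡⟨ *-comm (b ^ p) (b ^ e) ⟩
    b ^ e * b ^ p  ≡⟨ ^-distribˡ-+-* b e p ⟨
    b ^ m          ∎

  1+C≤b*C : suc C ≤ b * C
  1+C≤b*C = begin
    1 + C          ≤⟨ +-monoˡ-≤ C (s≤s z≤n) ⟩
    C + C          ≡⟨ cong (C +_) (+-identityʳ C) ⟨
    2 * C          ≤⟨ *-monoˡ-≤ C (nonTrivial⇒n>1 b) ⟩
    b * C          ∎

  -- The spare b^m beyond `C * b ^ m` is the room used for `b^m≤s` and `y′<s`.
  [1+C]b^m≤1+s : suc C * b ^ m ≤ suc s
  [1+C]b^m≤1+s = begin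
    suc C * b ^ m    ≤⟨ *-monoˡ-≤ (b ^ m) 1+C≤b*C ⟩
    b * C * b ^ m    ≡⟨ cong (_* b ^ m) (*-comm b C) ⟩
    C * b * b ^ m    ≡⟨ *-assoc C b (b ^ m) ⟩
    C * b ^ suc m    ≡⟨ suc-s ⟨
    suc s            ∎

  b^m≤s : b ^ m ≤ s
  b^m≤s = s≤s⁻¹ (begin
    1 + b ^ m        ≤⟨ +-monoˡ-≤ (b ^ m) (*-mono-≤ (s≤s (z≤n {c})) (m^n>0 b m)) ⟩
    C * b ^ m + b ^ m ≡⟨ +-comm (C * b ^ m) (b ^ m) ⟩
    suc C * b ^ m    ≤⟨ [1+C]b^m≤1+s ⟩
    suc s            ∎)

  y≤s+gD : y ≤ s + g * D
  y≤s+gD with ds , powerSum≡s , short ← shortExpansion {b} {e} waring s = begin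
    y                ≤⟨ S-≤ e (length ds) (≤-<-trans t≤x (fromDigits-< ds)) ⟩
    length ds * D    ≤⟨ short ⟩
    s + g * D        ∎
    where
    x = fromDigits ds
    Sx≡s : S e b x ≡ s
    Sx≡s = trans (S-fromDigits e ds) powerSum≡s
    x≢u : x ≢ u
    -- If x were u, the path from s to u in h steps would return to s at the next step.
    x≢u x≡u = no-periodic h b^m≤s
      (trans (iterate-suc e s h)
        (trans (cong (S e b) (trans (Attracted.reaches (proj₁ s-least)) (sym x≡u))) Sx≡s))
    t≤x : t ≤ x
    t≤x = proj₂ t-least x (attracted-preimage e x≢u
      (subst (Attracted h e b u) (sym Sx≡s) (proj₁ s-least)))

  s≮y : s ≮ y
  -- As h is `suc h′`, the height of `y′` can be read off its image, which it shares with y.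
  s≮y s<y = <⇒≱ y′<s (proj₂ s-least y′ (attracted-preimage e y′≢u
      (subst (Attracted h′ e b u) (sym Sy′≡Sy) (attracted-S e y-attracted))))
    where
    y-attracted : Attracted h e b u y
    y-attracted = attracted-S e (proj₁ t-least)
    r y′ : ℕ
    -- Since `suc s` is C * b^(1+m), r holds the digits of y below position m.
    r  = y ∸ suc s
    y′ = r + C * b ^ m
    1+s+r≡y : suc s + r ≡ y
    1+s+r≡y = m+[n∸m]≡n s<y
    -- The difference y - s is 1 + r; keeping this extra unit offsets the one in `suc s` when
    -- proving `y′<s`.
    1+r<b^m : suc r < b ^ m
    1+r<b^m = ≤-<-trans (+-cancelˡ-≤ s _ _ (begin
      s + suc r        ≡⟨ +-suc s r ⟩
      suc s + r        ≡⟨ 1+s+r≡y ⟩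
      y                ≤⟨ y≤s+gD ⟩
      s + g * D        ∎)) gD<b^m
    r<b^m : r < b ^ m
    r<b^m = <-trans (n<1+n r) 1+r<b^m
    y′<s : y′ < s
    y′<s = s≤s⁻¹ (begin-strict
      suc r + C * b ^ m  <⟨ +-monoˡ-< (C * b ^ m) 1+r<b^m ⟩
      suc C * b ^ m      ≤⟨ [1+C]b^m≤1+s ⟩
      suc s              ∎)
    Sy′≡Sy : S e b y′ ≡ S e b y
    Sy′≡Sy = begin-equality
      S e b (r + C * b ^ m)       ≡⟨ S-concat e m C r<b^m ⟩
      S e b r + S e b C           ≡⟨ S-concat e (suc m) C (<-≤-trans r<b^m (^-monoʳ-≤ b (n≤1+n m))) ⟨
      S e b (r + C * b ^ suc m)   ≡⟨ cong (S e b) (trans (+-comm r _) (trans (cong (_+ r) (sym suc-s)) 1+s+r≡y)) ⟩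
      S e b y                     ∎
    b^m≤y′ : b ^ m ≤ y′
    b^m≤y′ = ≤-trans (m≤m+n (b ^ m) (c * b ^ m)) (m≤n+m (C * b ^ m) r)
    y′≢u : y′ ≢ u
    -- From y, hence also from `y′`, h steps lead to u; if `y′` were u, it would be periodic.
    y′≢u y′≡u = no-periodic h′ b^m≤y′
      (trans (cong (λ z → iterate (S e b) z h′) Sy′≡Sy)
        (trans (Attracted.reaches y-attracted) (sym y′≡u)))

theorem3p3 : ∀ (b e h u : ℕ) .{{_ : NonTrivial b}} .{{_ : NonZero e}} .{{_ : NonZero h}} .{{_ : NonZero u}} →
    ∀ (g p : ℕ) → IsWaring e g → IsDigitBound b g p →
    take (suc (e + p)) (digits b (σ h e b u)) ≡ replicate (suc (e + p)) (b ∸ 1) →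
    S e b (σ (suc h) e b u) ≡ σ h e b u
theorem3p3 b e h u g p (waring , _) (g<b^p , _) trailing
  with c , suc-s ← digits-trailing (suc (e + p)) (σ h e b u) trailing
  = S-least-attracted b e h u g p waring g<b^p
      (proj₂ (least-attracted h e b u)) (proj₂ (least-attracted (suc h) e b u))
      c suc-s
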